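{- Let $n_1,n_2,n_3$ be integers with $3\le n_1,n_2\le n_3$. If $3\max(n_1,n_2)\le 2n_3\le n_1n_2$, then the direct product graph $K_{n_1+1}\times K_{n_2+1}\times K_{n_3+1}$ has metric dimension $2(n_3+1)-1=2n_3+1$.
   Context: $K_{m_1}\times K_{m_2}\times K_{m_3}$ denotes the direct product of complete graphs: vertices are triples $(x_1,x_2,x_3)$ with $1\le x_i\le m_i$, and two vertices are adjacent iff they differ in every coordinate. A set $W$ of vertices is resolving if for every two distinct vertices $x,y\notin W$ some $w\in W$ has $d(x,w)\ne d(y,w)$ ($d$ = graph distance). The metric dimension is the minimum size of a resolving set. -}

module Defs where

open import Data.Fin using (Fin)
open import Data.List using (List; length)
open import Data.List.Membership.Propositional using (_∈_; _∉_)
open import Data.List.Relation.Unary.Unique.Propositional using (Unique)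
open import Data.Nat using (ℕ; zero; suc; _≤_)
open import Data.Product using (_×_; _,_; ∃-syntax)
open import Level using (0ℓ)
open import Relation.Binary using (Rel; Symmetric)
open import Relation.Binary.PropositionalEquality using (_≡_; _≢_; refl; ≢-sym)
open import Relation.Nullary using (¬_)

record Graph : Set₁ where
  field
    Vertex : Set
    Adj    : Rel Vertex 0ℓ
    symm   : Symmetric Adj
    irrefl : ∀ {x} → ¬ Adj x x

open Graph public

K : ℕ → Graph
K m = record
  { Vertex = Fin m
  ; Adj    = _≢_
  ; symm   = ≢-sym
  ; irrefl = λ x≢x → x≢x refl
  }

infixr 6 _⊗_

_⊗_ : Graph → Graph → Graph
G ⊗ H = record
  { Vertex = Vertex G × Vertex H
  ; Adj    = λ (x , u) (y , v) → Adj G x y × Adj H u v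
  ; symm   = λ (p , q) → symm G p , symm H q
  ; irrefl = λ (p , _) → irrefl G p
  }

module _ (G : Graph) where

  data Walk : ℕ → Vertex G → Vertex G → Set where
    []  : ∀ {x} → Walk zero x x
    _∷_ : ∀ {k x y z} → Adj G x y → Walk k y z → Walk (suc k) x z

  -- IsDistance x y k encodes d(x,y) = k; it is a relation because d is
  -- a total ℕ-valued function only on connected graphs.
  IsDistance : Vertex G → Vertex G → ℕ → Set
  IsDistance x y k = Walk k x y × (∀ l → Walk l x y → k ≤ l)

  -- d(x,w) ≠ d(y,w), both distances being finite.
  Resolves : Vertex G → Vertex G → Vertex G → Set
  Resolves w x y =
    ∃[ k ] ∃[ l ] IsDistance x w k × IsDistance y w l × k ≢ l

  Resolving : List (Vertex G) → Set
  Resolving W =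
    ∀ x y → x ≢ y → x ∉ W → y ∉ W → ∃[ w ] w ∈ W × Resolves w x y

  -- Finite vertex sets are duplicate-free lists, with length as cardinality.
  HasMetricDimension : ℕ → Set
  HasMetricDimension k =
    (∃[ W ] Unique W × Resolving W × length W ≡ k) ×
    (∀ W → Unique W → Resolving W → k ≤ length W)

{-# OPTIONS --safe #-}

-- Distances are at most 2, so w separates x and y (all distinct) exactly when one of x, y agrees
-- with w in some coordinate and the other does not.
--
-- Lower bound: if the layers x₃ = a and x₃ = b contain at most two elements of W, one can choose
-- (p , q) meeting all of them while (p,q,a), (p,q,b) ∉ W; these two vertices are not separated.
-- Hence any two layers contain at least 3 elements together, and so |W| ≥ 2n₃ + 1.
--
-- Upper bound: W is the origin together with two vertices in each of the n₃ other layers, lying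
-- over cells of the n₁ × n₂ grid.  It resolves as soon as the cells are distinct, the two cells
-- of a layer are in general position, every row and column contains at least three cells, and
-- the opposite corners of the rectangles spanned by the layers are distinct.  Such arrangements
-- are built by adding two columns, or four rows and four columns, to finitely many small ones.
module Submission where

open import Data.Bool using (Bool; true; false; not)
open import Data.Bool.Properties using (not-involutive)
open import Data.Empty using (⊥-elim)
open import Data.Fin using (Fin; zero; suc; toℕ; fromℕ<)
open import Data.Fin.Properties using (suc-injective; toℕ<n; toℕ-injective; toℕ-fromℕ<) renaming (_≟_ to _≟ᶠ_)
open import Data.List using (List; []; _∷_; length; filter; _++_; tabulate; lookup; take; map; applyUpTo)
open import Data.List.Membership.Propositional using (_∈_; _∉_)
open import Data.List.Membership.Propositional.Properties using (∈-filter⁺; ∈-++⁺ˡ; ∈-++⁺ʳ; ∈-tabulate⁺; ∈-tabulate⁻; ∈-lookup)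
open import Data.List.Properties using (length-++; length-tabulate; length-applyUpTo; length-map)
open import Data.List.Relation.Binary.Sublist.Propositional using (_⊆_; []; _∷_; _∷ʳ_; ⊆-refl)
open import Data.List.Relation.Binary.Sublist.Propositional.Properties using (take-⊆; ++⁺; ++⁺ʳ; ++⁺ˡ; filter⁺; length-mono-≤; All-resp-⊆; map⁺)
open import Data.List.Relation.Unary.All as All using (All; []; _∷_)
import Data.List.Relation.Unary.All.Properties as All
open import Data.List.Relation.Unary.AllPairs as AllPairs using (AllPairs; []; _∷_)
import Data.List.Relation.Unary.AllPairs.Properties as AllPairs
open import Data.List.Relation.Unary.Any using (here; there)
open import Data.List.Relation.Unary.Unique.Propositional using (Unique)
import Data.List.Relation.Unary.Unique.Propositional.Properties as Unique
open import Data.Nat using (ℕ; zero; suc; _+_; _*_; _∸_; _≤_; _<_; _⊔_; z≤n; s≤s; NonZero; _≟_; _≤?_; _<?_)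
open import Data.Nat.Divisibility using (_∣_; _∣?_; divides; ∣m+n∣m⇒∣n)
open import Data.Nat.DivMod using (_/_; _%_)
open import Data.Nat.Properties hiding (suc-injective; _≟_; _≤?_; _<?_)
import Data.Nat.Properties as Nat
open import Data.Nat.Solver using (module +-*-Solver)
open import Data.Product as Product using (_×_; _,_; ∃-syntax; proj₁; proj₂; swap)
open import Data.Sum using (_⊎_; inj₁; inj₂; [_,_]′)
open import Function using (_∘_)
open import Relation.Binary.PropositionalEquality
open import Relation.Nullary
open import Relation.Nullary.Decidable using (True; toWitness; toWitnessFalse; decidable-stable; _×-dec_; _⊎-dec_; _→-dec_; ¬?; map′)
open import Relation.Unary using (Decidable)
open import Defs

-- Counting: sums over `Fin m` and the sizes of fibres.

avoid : ∀ {n} → 2 ≤ n → (a b : Fin (suc n)) → ∃[ c ] c ≢ a × c ≢ b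
avoid (s≤s (s≤s _)) zero          zero          = suc zero , (λ ()) , λ ()
avoid (s≤s (s≤s _)) zero          (suc zero)    = suc (suc zero) , (λ ()) , λ ()
avoid (s≤s (s≤s _)) zero          (suc (suc _)) = suc zero , (λ ()) , λ ()
avoid (s≤s (s≤s _)) (suc zero)    zero          = suc (suc zero) , (λ ()) , λ ()
avoid (s≤s (s≤s _)) (suc (suc _)) zero          = suc zero , (λ ()) , λ ()
avoid (s≤s (s≤s _)) (suc _)       (suc _)       = zero , (λ ()) , λ ()

Σᶠ : ∀ {m} → (Fin m → ℕ) → ℕ
Σᶠ {zero}  f = 0
Σᶠ {suc m} f = f zero + Σᶠ (f ∘ suc)

Σᶠ-mono : ∀ {m} (f g : Fin m → ℕ) → (∀ a → f a ≤ g a) → Σᶠ f ≤ Σᶠ g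
Σᶠ-mono {zero}  f g f≤g = z≤n
Σᶠ-mono {suc m} f g f≤g = +-mono-≤ (f≤g zero) (Σᶠ-mono (f ∘ suc) (g ∘ suc) (f≤g ∘ suc))

-- For the induction in `Σᶠ-fibre`: putting one more element on a list raises only the count of its
-- own fibre.
Σᶠ-bump : ∀ {m} (f g : Fin m → ℕ) c →
  (∀ a → a ≢ c → f a ≤ g a) → f c ≤ suc (g c) → Σᶠ f ≤ suc (Σᶠ g)
Σᶠ-bump f g zero f≤g fc≤ =
  +-mono-≤ fc≤ (Σᶠ-mono (f ∘ suc) (g ∘ suc) λ a → f≤g (suc a) λ ())
Σᶠ-bump f g (suc c) f≤g fc≤ = ≤-trans
  (+-mono-≤ (f≤g zero λ ())
    (Σᶠ-bump (f ∘ suc) (g ∘ suc) c (λ a a≢c → f≤g (suc a) (a≢c ∘ suc-injective)) fc≤))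
  (≤-reflexive (+-suc (g zero) _))

Σᶠ-const : ∀ {m} k (f : Fin m → ℕ) → (∀ a → k ≤ f a) → k * m ≤ Σᶠ f
Σᶠ-const {zero}  k f k≤f = ≤-reflexive (*-zeroʳ k)
Σᶠ-const {suc m} k f k≤f = begin
  k * suc m            ≡⟨ *-suc k m ⟩
  k + k * m            ≤⟨ +-mono-≤ (k≤f zero) (Σᶠ-const k (f ∘ suc) (k≤f ∘ suc)) ⟩
  f zero + Σᶠ (f ∘ suc) ∎
  where open ≤-Reasoning

-- Case on the first value. If it is 0, all others are at least 3; if it is 1, all others are at
-- least 2; otherwise it pays for its own 2 and the remaining values still satisfy the hypothesis,
-- down to a single pair.
Σᶠ-pairwise : ∀ m (f : Fin (2 + m) → ℕ) → (∀ a b → a ≢ b → 3 ≤ f a + f b) →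
  2 * suc m + 1 ≤ Σᶠ f
Σᶠ-pairwise m f 3≤ with f zero in eq
... | 0 = begin
  2 * suc m + 1              ≤⟨ +-monoʳ-≤ (2 * suc m) (s≤s (z≤n {m})) ⟩
  2 * suc m + suc m          ≡⟨ +-comm (2 * suc m) _ ⟩
  3 * suc m
    ≤⟨ Σᶠ-const 3 (f ∘ suc) (λ a → subst (λ k → 3 ≤ k + f (suc a)) eq (3≤ zero (suc a) λ ())) ⟩
  Σᶠ (f ∘ suc)               ∎
  where open ≤-Reasoning
... | 1 = begin
  2 * suc m + 1              ≡⟨ +-comm (2 * suc m) 1 ⟩
  suc (2 * suc m)
    ≤⟨ s≤s (Σᶠ-const 2 (f ∘ suc) (λ a → ≤-pred (subst (λ k → 3 ≤ k + f (suc a)) eq (3≤ zero (suc a) λ ())))) ⟩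
  suc (Σᶠ (f ∘ suc))         ∎
  where open ≤-Reasoning
Σᶠ-pairwise zero f 3≤ | suc (suc k) = begin
  3                                 ≤⟨ 3≤ zero (suc zero) (λ ()) ⟩
  f zero + f (suc zero)             ≡⟨ cong₂ _+_ eq (sym (+-identityʳ _)) ⟩
  suc (suc k) + (f (suc zero) + 0)  ∎
  where open ≤-Reasoning
Σᶠ-pairwise (suc m) f 3≤ | suc (suc k) = begin
  2 * suc (suc m) + 1             ≡⟨ cong (_+ 1) (*-suc 2 (suc m)) ⟩
  2 + (2 * suc m + 1)
    ≤⟨ +-mono-≤ (s≤s (s≤s (z≤n {k}))) (Σᶠ-pairwise m (f ∘ suc) λ a b a≢b → 3≤ (suc a) (suc b) (a≢b ∘ suc-injective)) ⟩
  suc (suc k) + Σᶠ (f ∘ suc)      ∎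
  where open ≤-Reasoning

fibre : ∀ {A : Set} {m} → (A → Fin m) → Fin m → List A → List A
fibre g a = filter (λ w → g w ≟ᶠ a)

Σᶠ-fibre : ∀ {A : Set} {m} (g : A → Fin m) W → Σᶠ (λ a → length (fibre g a W)) ≤ length W
Σᶠ-fibre {m = m} g [] = Σᶠ-zero m
  where
  Σᶠ-zero : ∀ m → Σᶠ {m} (λ _ → 0) ≤ 0
  Σᶠ-zero zero    = z≤n
  Σᶠ-zero (suc m) = Σᶠ-zero m
Σᶠ-fibre {m = m} g (w ∷ W) =
  ≤-trans (Σᶠ-bump _ (λ a → length (fibre g a W)) (g w) other same) (s≤s (Σᶠ-fibre g W))
  where
  other : ∀ a → a ≢ g w → length (fibre g a (w ∷ W)) ≤ length (fibre g a W)
  other a a≢ with g w ≟ᶠ a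
  ... | yes eq = ⊥-elim (a≢ (sym eq))
  ... | no  _  = ≤-refl
  same : length (fibre g (g w) (w ∷ W)) ≤ suc (length (fibre g (g w) W))
  same with does (g w ≟ᶠ g w)
  ... | true  = ≤-refl
  ... | false = n≤1+n _

∈-length≤2 : ∀ {A : Set} → A → (V : List A) → length V ≤ 2 →
  ∃[ u ] ∃[ v ] ∀ {w} → w ∈ V → w ≡ u ⊎ w ≡ v
∈-length≤2 o []          _ = o , o , λ ()
∈-length≤2 o (u ∷ [])    _ = u , u , λ { (here eq) → inj₁ eq }
∈-length≤2 o (u ∷ v ∷ []) _ = u , v , λ { (here eq) → inj₁ eq ; (there (here eq)) → inj₂ eq }
∈-length≤2 o (_ ∷ _ ∷ _ ∷ _) (s≤s (s≤s ()))

-- Distances in the product, and the lower bound.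

module CompleteProduct {n₁ n₂ n₃ : ℕ} (2≤n₁ : 2 ≤ n₁) (2≤n₂ : 2 ≤ n₂) (2≤n₃ : 2 ≤ n₃) where

  G : Graph
  G = K (suc n₁) ⊗ K (suc n₂) ⊗ K (suc n₃)

  V : Set
  V = Vertex G

  Meets : V → V → Set
  Meets (x₁ , x₂ , x₃) (w₁ , w₂ , w₃) = x₁ ≡ w₁ ⊎ x₂ ≡ w₂ ⊎ x₃ ≡ w₃

  meets⇒¬adj : ∀ {x w} → Meets x w → ¬ Adj G x w
  meets⇒¬adj (inj₁ eq)        (≢₁ , _)      = ≢₁ eq
  meets⇒¬adj (inj₂ (inj₁ eq)) (_ , ≢₂ , _)  = ≢₂ eq
  meets⇒¬adj (inj₂ (inj₂ eq)) (_ , _ , ≢₃)  = ≢₃ eq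

  meets? : ∀ x w → Meets x w ⊎ Adj G x w
  meets? (x₁ , x₂ , x₃) (w₁ , w₂ , w₃) with x₁ ≟ᶠ w₁ | x₂ ≟ᶠ w₂ | x₃ ≟ᶠ w₃
  ... | yes p | _     | _     = inj₁ (inj₁ p)
  ... | no _  | yes p | _     = inj₁ (inj₂ (inj₁ p))
  ... | no _  | no _  | yes p = inj₁ (inj₂ (inj₂ p))
  ... | no p  | no q  | no r  = inj₂ (p , q , r)

  adj⇒distance1 : ∀ {x w} → Adj G x w → IsDistance G x w 1
  adj⇒distance1 {x} {w} adj = adj ∷ [] , minimal
    where
    minimal : ∀ l → Walk G l x w → 1 ≤ l
    minimal _ []      = ⊥-elim (irrefl G {x} adj)
    minimal _ (_ ∷ _) = s≤s z≤n

  -- Every factor has at least three vertices, so in each coordinate some value differs from both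
  -- ends; together these values form a common neighbour.
  meets⇒distance2 : ∀ {x w} → x ≢ w → Meets x w → IsDistance G x w 2
  meets⇒distance2 {x@(x₁ , x₂ , x₃)} {w@(w₁ , w₂ , w₃)} x≢w meets
    with avoid 2≤n₁ x₁ w₁ | avoid 2≤n₂ x₂ w₂ | avoid 2≤n₃ x₃ w₃
  ... | z₁ , a₁ , b₁ | z₂ , a₂ , b₂ | z₃ , a₃ , b₃ = walk , minimal
    where
    walk : Walk G 2 x w
    walk = (≢-sym a₁ , ≢-sym a₂ , ≢-sym a₃) ∷ ((b₁ , b₂ , b₃) ∷ [])
    minimal : ∀ l → Walk G l x w → 2 ≤ l
    minimal _ []            = ⊥-elim (x≢w refl)
    minimal _ (adj ∷ [])    = ⊥-elim (meets⇒¬adj meets adj)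
    minimal _ (_ ∷ (_ ∷ _)) = s≤s (s≤s z≤n)

  distance-unique : ∀ {x w k l} → IsDistance G x w k → IsDistance G x w l → k ≡ l
  distance-unique (p , p≤) (q , q≤) = ≤-antisym (p≤ _ q) (q≤ _ p)

  resolves-sym : ∀ {w x y} → Resolves G w x y → Resolves G w y x
  resolves-sym (k , l , dx , dy , k≢l) = l , k , dy , dx , ≢-sym k≢l

  meets-adj⇒resolves : ∀ {w x y} → x ≢ w → Meets x w → Adj G y w → Resolves G w x y
  meets-adj⇒resolves x≢w meets adj =
    2 , 1 , meets⇒distance2 x≢w meets , adj⇒distance1 adj , λ ()

  -- If `w` agrees with `p` or `q`, both distances are 2. If it agrees with neither and lies in
  -- neither layer, both are 1.
  resolves⇒layer : ∀ {w p q a b} → (p , q , a) ≢ w → (p , q , b) ≢ w →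
    Resolves G w (p , q , a) (p , q , b) →
    p ≢ proj₁ w × q ≢ proj₁ (proj₂ w) × (proj₂ (proj₂ w) ≡ a ⊎ proj₂ (proj₂ w) ≡ b)
  resolves⇒layer {w@(w₁ , w₂ , w₃)} {p} {q} {a} {b} xw yw (k , l , dx , dy , k≢l)
    with meets? (p , q , a) w | meets? (p , q , b) w
  ... | inj₁ mx | inj₁ my = ⊥-elim (k≢l (trans (distance-unique dx (meets⇒distance2 xw mx))
                                             (distance-unique (meets⇒distance2 yw my) dy)))
  ... | inj₂ ax | inj₂ ay = ⊥-elim (k≢l (trans (distance-unique dx (adj⇒distance1 ax))
                                             (distance-unique (adj⇒distance1 ay) dy)))
  ... | inj₁ (inj₁ eq)        | inj₂ (≢₁ , _)     = ⊥-elim (≢₁ eq)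
  ... | inj₁ (inj₂ (inj₁ eq)) | inj₂ (_ , ≢₂ , _) = ⊥-elim (≢₂ eq)
  ... | inj₁ (inj₂ (inj₂ eq)) | inj₂ (≢₁ , ≢₂ , _) = ≢₁ , ≢₂ , inj₁ (sym eq)
  ... | inj₂ (≢₁ , _)     | inj₁ (inj₁ eq)        = ⊥-elim (≢₁ eq)
  ... | inj₂ (_ , ≢₂ , _) | inj₁ (inj₂ (inj₁ eq)) = ⊥-elim (≢₂ eq)
  ... | inj₂ (≢₁ , ≢₂ , _) | inj₁ (inj₂ (inj₂ eq)) = ≢₁ , ≢₂ , inj₂ (sym eq)

  third : V → Fin (suc n₃)
  third (_ , _ , w₃) = w₃

  Blocks : Fin (suc n₁) → Fin (suc n₂) → V → Set
  Blocks p q (w₁ , w₂ , _) = (p ≡ w₁ ⊎ q ≡ w₂) × ¬ (p ≡ w₁ × q ≡ w₂)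

  -- (p , q) chosen so that neither u nor v separates (p,q,a) from (p,q,b) or equals one of them.
  common-block : ∀ u v → ∃[ p ] ∃[ q ] Blocks p q u × Blocks p q v
  common-block (u₁ , u₂ , _) (v₁ , v₂ , _) with u₁ ≟ᶠ v₁ | u₂ ≟ᶠ v₂
  ... | yes refl | _ with avoid 2≤n₂ u₂ v₂
  ...   | q , q≢u , q≢v = u₁ , q , (inj₁ refl , q≢u ∘ proj₂) , (inj₁ refl , q≢v ∘ proj₂)
  common-block (u₁ , u₂ , _) (v₁ , v₂ , _) | no _ | yes refl with avoid 2≤n₁ u₁ v₁
  ...   | p , p≢u , p≢v = p , u₂ , (inj₂ refl , p≢u ∘ proj₁) , (inj₂ refl , p≢v ∘ proj₁)
  common-block (u₁ , u₂ , _) (v₁ , v₂ , _) | no u₁≢v₁ | no u₂≢v₂ =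
    u₁ , v₂ , (inj₁ refl , u₂≢v₂ ∘ sym ∘ proj₂) , (inj₂ refl , u₁≢v₁ ∘ proj₁)

  two-layers : ∀ W → Resolving G W → ∀ a b → a ≢ b →
    3 ≤ length (fibre third a W) + length (fibre third b W)
  two-layers W res a b a≢b with 3 ≤? length (fibre third a W) + length (fibre third b W)
  ... | yes 3≤ = 3≤
  -- The vertex `(zero , zero , zero)` is a placeholder for the case that both fibres are empty.
  ... | no ¬3≤ with ∈-length≤2 (zero , zero , zero) (fibre third a W ++ fibre third b W)
                      (subst (_≤ 2) (sym (length-++ (fibre third a W))) (≤-pred (≰⇒> ¬3≤)))
  ...   | u , v , only with common-block u v
  ...     | p , q , bu , bv = ⊥-elim (absurd (res (p , q , a) (p , q , b)
                                  (a≢b ∘ cong third) (∉W inj₁) (∉W inj₂)))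
    where
    blocked : ∀ {w} → w ∈ W → third w ≡ a ⊎ third w ≡ b → Blocks p q w
    blocked {w} w∈W layer with only ([ (λ eq → ∈-++⁺ˡ (∈-filter⁺ (λ z → third z ≟ᶠ a) w∈W eq))
                                     , (λ eq → ∈-++⁺ʳ (fibre third a W) (∈-filter⁺ (λ z → third z ≟ᶠ b) w∈W eq)) ]′ layer)
    ... | inj₁ refl = bu
    ... | inj₂ refl = bv
    -- A member of `W` over `(p , q)` in one of the two layers would have to be blocked, but
    -- `Blocks` rules out agreement in both coordinates.
    ∉W : ∀ {c} → (∀ {d} → d ≡ c → d ≡ a ⊎ d ≡ b) → (p , q , c) ∉ W
    ∉W c∈ab ∈W = proj₂ (blocked ∈W (c∈ab refl)) (refl , refl)
    absurd : ¬ (∃[ w ] w ∈ W × Resolves G w (p , q , a) (p , q , b))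
    absurd (w , w∈W , r) with resolves⇒layer (λ { refl → ∉W inj₁ w∈W }) (λ { refl → ∉W inj₂ w∈W }) r
    ... | p≢ , q≢ , layer = [ p≢ , q≢ ]′ (proj₁ (blocked w∈W layer))

  lower-bound : ∀ W → Resolving G W → 2 * n₃ + 1 ≤ length W
  lower-bound W res = ≤-trans (sum≥ 2≤n₃ (λ a → length (fibre third a W)) (two-layers W res)) (Σᶠ-fibre third W)
    where
    sum≥ : ∀ {n} → 2 ≤ n → (f : Fin (suc n) → ℕ) → (∀ a b → a ≢ b → 3 ≤ f a + f b) → 2 * n + 1 ≤ Σᶠ f
    sum≥ (s≤s _) = Σᶠ-pairwise _

-- Layer i of the resolving set consists of the vertices over (row i s , col i s), s : Bool.  The
-- rich fields say that a line keeps a cell after discarding one crossing line and one layer.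
record Design (n₁ n₂ n₃ : ℕ) : Set where
  field
    row : Fin n₃ → Bool → Fin n₁
    col : Fin n₃ → Bool → Fin n₂
    row-skew : ∀ i → row i false ≢ row i true
    col-skew : ∀ i → col i false ≢ col i true
    opposite-injective : ∀ {i j s t} → row i s ≡ row j t →
      col i (not s) ≡ col j (not t) → i ≡ j
    row-rich : ∀ r (c : Fin (suc n₂)) (k : Fin (suc n₃)) →
      ∃[ i ] ∃[ s ] row i s ≡ r × suc (col i s) ≢ c × suc i ≢ k
    col-rich : ∀ c (r : Fin (suc n₁)) (k : Fin (suc n₃)) →
      ∃[ i ] ∃[ s ] col i s ≡ c × suc (row i s) ≢ r × suc i ≢ k

transpose-design : ∀ {n₁ n₂ n₃} → Design n₁ n₂ n₃ → Design n₂ n₁ n₃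
transpose-design D = record
  { row = col ; col = row ; row-skew = col-skew ; col-skew = row-skew
  -- After the swap the same corner is indexed by its other end, hence the negated `s` and `t`.
  ; opposite-injective = λ {i} {j} {s} {t} c≡ r≡ → opposite-injective {s = not s} {not t} r≡
      (subst₂ (λ s′ t′ → col i s′ ≡ col j t′) (sym (not-involutive s)) (sym (not-involutive t)) c≡)
  ; row-rich = col-rich ; col-rich = row-rich }
  where open Design D

-- The resolving set given by a design.

module _ {n₁ n₂ n₃ : ℕ} (2≤n₁ : 2 ≤ n₁) (2≤n₂ : 2 ≤ n₂) (2≤n₃ : 2 ≤ n₃) (D : Design n₁ n₂ n₃) where
  open CompleteProduct 2≤n₁ 2≤n₂ 2≤n₃
  open Design D

  origin : V
  origin = zero , zero , zero

  vertex : Bool → Fin n₃ → V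
  vertex s i = suc (row i s) , suc (col i s) , suc i

  basis : List V
  basis = origin ∷ tabulate (vertex false) ++ tabulate (vertex true)

  origin∈ : origin ∈ basis
  origin∈ = here refl

  vertex∈ : ∀ s i → vertex s i ∈ basis
  vertex∈ false i = there (∈-++⁺ˡ (∈-tabulate⁺ {f = vertex false} i))
  vertex∈ true  i = there (∈-++⁺ʳ (tabulate (vertex false)) (∈-tabulate⁺ {f = vertex true} i))

  length-basis : length basis ≡ 2 * n₃ + 1
  length-basis = begin
    suc (length (tabulate (vertex false) ++ tabulate (vertex true)))
      ≡⟨ cong suc (length-++ (tabulate (vertex false))) ⟩
    suc (length (tabulate (vertex false)) + length (tabulate (vertex true)))
      ≡⟨ cong suc (cong₂ _+_ (length-tabulate (vertex false)) (length-tabulate (vertex true))) ⟩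
    suc (n₃ + n₃)
      ≡⟨ cong (λ k → suc (n₃ + k)) (sym (+-identityʳ n₃)) ⟩
    suc (2 * n₃)
      ≡⟨ +-comm 1 (2 * n₃) ⟩
    2 * n₃ + 1 ∎
    where open ≡-Reasoning

  basis-unique : Unique basis
  basis-unique =
    All.++⁺ (All.tabulate⁺ {f = vertex false} λ _ ()) (All.tabulate⁺ {f = vertex true} λ _ ()) ∷
    Unique.++⁺ (Unique.tabulate⁺ vertex-injective) (Unique.tabulate⁺ vertex-injective)
      λ { (∈₀ , ∈₁) → disjoint (∈-tabulate⁻ ∈₀) (∈-tabulate⁻ ∈₁) }
    where
    vertex-injective : ∀ {s i j} → vertex s i ≡ vertex s j → i ≡ j
    vertex-injective = suc-injective ∘ cong third
    disjoint : ∀ {v} → ∃[ i ] v ≡ vertex false i → ¬ (∃[ j ] v ≡ vertex true j)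
    disjoint (i , eq) (j , eq′) with suc-injective (cong third (trans (sym eq) eq′))
    ... | refl = row-skew i (suc-injective (cong proj₁ (trans (sym eq) eq′)))

  Distinguished : V → V → Set
  Distinguished x y = ∃[ w ] w ∈ basis × Resolves G w x y

  distinguished-sym : ∀ {x y} → Distinguished x y → Distinguished y x
  distinguished-sym {x} {y} (w , w∈ , r) = w , w∈ , resolves-sym {w} {x} {y} r

  distinguish : ∀ {w x y} → w ∈ basis → x ∉ basis → Meets x w → Adj G y w → Distinguished x y
  distinguish {w} {x} {y} w∈ x∉ meets adj =
    w , w∈ , meets-adj⇒resolves {w} {x} {y} (λ { refl → x∉ w∈ }) meets adj

  -- Richness of row `r` supplies a basis vertex that shares this row with the first vertex and
  -- avoids the column and the layer of the second, to which it is therefore adjacent.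
  by-row : ∀ {r x₂ x₃ y₁ y₂ y₃} → (suc r , x₂ , x₃) ∉ basis → suc r ≢ y₁ →
    Distinguished (suc r , x₂ , x₃) (y₁ , y₂ , y₃)
  by-row {r} {y₂ = y₂} {y₃} x∉ r≢ with row-rich r y₂ y₃
  ... | i , s , refl , c≢ , k≢ =
    distinguish (vertex∈ s i) x∉ (inj₁ refl) (≢-sym r≢ , ≢-sym c≢ , ≢-sym k≢)

  by-col : ∀ {c x₁ x₃ y₁ y₂ y₃} → (x₁ , suc c , x₃) ∉ basis → suc c ≢ y₂ →
    Distinguished (x₁ , suc c , x₃) (y₁ , y₂ , y₃)
  by-col {c} {y₁ = y₁} {y₃ = y₃} x∉ c≢ with col-rich c y₁ y₃
  ... | i , s , refl , r≢ , k≢ =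
    distinguish (vertex∈ s i) x∉ (inj₂ (inj₁ refl)) (≢-sym r≢ , ≢-sym c≢ , ≢-sym k≢)

  Untouched Opposite : Fin n₃ → Fin (suc n₁) → Fin (suc n₂) → Set
  Untouched i p q = ∃[ s ] p ≢ suc (row i s) × q ≢ suc (col i s)
  Opposite  i p q = ∃[ s ] p ≡ suc (row i s) × q ≡ suc (col i (not s))

  -- By skewness `p` is the row of at most one of the two cells and `q` the column of at most one.
  -- If both cells are touched, one is touched by its row and the other by its column.
  untouched-or-opposite : ∀ i p q → Untouched i p q ⊎ Opposite i p q
  untouched-or-opposite i p q
    with p ≟ᶠ suc (row i false) | q ≟ᶠ suc (col i false) | p ≟ᶠ suc (row i true) | q ≟ᶠ suc (col i true)
  ... | no p≢    | no q≢    | _        | _        = inj₁ (false , p≢ , q≢)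
  ... | _        | _        | no p≢    | no q≢    = inj₁ (true , p≢ , q≢)
  ... | yes p≡   | _        | _        | yes q≡   = inj₂ (false , p≡ , q≡)
  ... | _        | yes q≡   | yes p≡   | _        = inj₂ (true , p≡ , q≡)
  ... | yes p≡   | _        | yes p≡′  | _        = ⊥-elim (row-skew i (suc-injective (trans (sym p≡) p≡′)))
  ... | _        | yes q≡   | _        | yes q≡′  = ⊥-elim (col-skew i (suc-injective (trans (sym q≡) q≡′)))

  by-untouched : ∀ {i p q y₃} → (p , q , suc i) ∉ basis → suc i ≢ y₃ → Untouched i p q →
    Distinguished (p , q , suc i) (p , q , y₃)
  by-untouched {i} x∉ i≢ (s , p≢ , q≢) =
    distinguish (vertex∈ s i) x∉ (inj₂ (inj₂ refl)) (p≢ , q≢ , ≢-sym i≢)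

  by-layer : ∀ p q x₃ y₃ → x₃ ≢ y₃ → (p , q , x₃) ∉ basis → (p , q , y₃) ∉ basis →
    Distinguished (p , q , x₃) (p , q , y₃)
  by-layer p q zero    zero    ≢₃ x∉ y∉ = ⊥-elim (≢₃ refl)
  by-layer p q zero    (suc j) ≢₃ x∉ y∉ = distinguished-sym (by-layer p q (suc j) zero (≢-sym ≢₃) y∉ x∉)
  by-layer p q (suc i) zero    ≢₃ x∉ y∉ with untouched-or-opposite i p q
  ... | inj₁ un = by-untouched x∉ ≢₃ un
  -- At an opposite corner both `p` and `q` are nonzero, so the origin is adjacent to the vertex in
  -- layer `suc i`, while it shares layer `zero` with the other one.
  ... | inj₂ (_ , refl , refl) =
    distinguished-sym (distinguish origin∈ y∉ (inj₂ (inj₂ refl)) ((λ ()) , (λ ()) , λ ()))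
  by-layer p q (suc i) (suc j) ≢₃ x∉ y∉ with untouched-or-opposite i p q | untouched-or-opposite j p q
  ... | inj₁ un | _       = by-untouched x∉ ≢₃ un
  ... | _       | inj₁ un = distinguished-sym (by-untouched y∉ (≢-sym ≢₃) un)
  ... | inj₂ (s , p≡ , q≡) | inj₂ (t , p≡′ , q≡′) = ⊥-elim (≢₃ (cong suc (opposite-injective {s = s} {t}
          (suc-injective (trans (sym p≡) p≡′)) (suc-injective (trans (sym q≡) q≡′)))))

  basis-resolving : Resolving G basis
  basis-resolving (x₁ , x₂ , x₃) (y₁ , y₂ , y₃) x≢y x∉ y∉ with x₁ ≟ᶠ y₁ | x₂ ≟ᶠ y₂
  basis-resolving (suc _ , _) _ _ x∉ _ | no ≢₁ | _ = by-row x∉ ≢₁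
  basis-resolving (zero , _) (suc _ , _) _ _ y∉ | no ≢₁ | _ = distinguished-sym (by-row y∉ (≢-sym ≢₁))
  basis-resolving (zero , _) (zero , _) _ _ _ | no ≢₁ | _ = ⊥-elim (≢₁ refl)
  basis-resolving (_ , suc _ , _) _ _ x∉ _ | yes _ | no ≢₂ = by-col x∉ ≢₂
  basis-resolving (_ , zero , _) (_ , suc _ , _) _ _ y∉ | yes _ | no ≢₂ = distinguished-sym (by-col y∉ (≢-sym ≢₂))
  basis-resolving (_ , zero , _) (_ , zero , _) _ _ _ | yes _ | no ≢₂ = ⊥-elim (≢₂ refl)
  ... | yes refl | yes refl = by-layer x₁ x₂ x₃ y₃ (x≢y ∘ cong (λ c → x₁ , x₂ , c)) x∉ y∉

  metric-dimension : HasMetricDimension G (2 * n₃ + 1)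
  metric-dimension = (basis , basis-unique , basis-resolving , length-basis) , λ W _ → lower-bound W

-- Packings of duos into a grid, and operations on them.

-- The two cells occupied by one layer of the resolving set.
Duo : Set
Duo = Bool → ℕ × ℕ

duo : ℕ → ℕ → ℕ → ℕ → Duo
duo a b c d false = a , b
duo a b c d true  = c , d

row col : Duo → Bool → ℕ
row e s = proj₁ (e s)
col e s = proj₂ (e s)

Skew : Duo → Set
Skew e = row e false ≢ row e true × col e false ≢ col e true

Within : ℕ → ℕ → Duo → Set
Within n₁ n₂ e = ∀ s → row e s < n₁ × col e s < n₂

Placed : ℕ → ℕ → Duo → Set
Placed n₁ n₂ e = Skew e × Within n₁ n₂ e

-- Distinct cells, and distinct opposite corners of the rectangles spanned by the two duos.
Compatible : Duo → Duo → Set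
Compatible e f = ∀ s t → row e s ≡ row f t →
  col e s ≢ col f t × col e (not s) ≢ col f (not t)

∀Bool? : {P : Bool → Set} → Decidable P → Dec (∀ s → P s)
∀Bool? P? = map′ (λ { (p , q) false → p ; (p , q) true → q }) (λ p → p false , p true)
  (P? false ×-dec P? true)

placed? : ∀ n₁ n₂ → Decidable (Placed n₁ n₂)
placed? n₁ n₂ e = (¬? (row e false ≟ row e true) ×-dec ¬? (col e false ≟ col e true)) ×-dec
  ∀Bool? (λ s → (row e s <? n₁) ×-dec (col e s <? n₂))

compatible? : ∀ e f → Dec (Compatible e f)
compatible? e f = ∀Bool? λ s → ∀Bool? λ t → (row e s ≟ row f t) →-dec
  (¬? (col e s ≟ col f t) ×-dec ¬? (col e (not s) ≟ col f (not t)))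

Hits : (ℕ × ℕ → ℕ) → ℕ → Duo → Set
Hits π k e = π (e false) ≡ k ⊎ π (e true) ≡ k

hits? : ∀ π k → Decidable (Hits π k)
hits? π k e = (π (e false) ≟ k) ⊎-dec (π (e true) ≟ k)

-- Duos are counted, not cells. A skew duo has at most one cell on a row or column, so for these
-- lines the two counts agree, and different duos stand for different layers.
degree : (ℕ × ℕ → ℕ) → ℕ → List Duo → ℕ
degree π k L = length (filter (hits? π k) L)

degree-⊆ : ∀ π k {L M} → L ⊆ M → degree π k L ≤ degree π k M
degree-⊆ π k L⊆M = length-mono-≤ (filter⁺ (hits? π k) (hits? π k) (λ { refl p → p }) L⊆M)

length-filter-map : ∀ {A B : Set} {P : A → Set} {Q : B → Set} (P? : Decidable P) (Q? : Decidable Q)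
  (f : A → B) → (∀ {x} → P x → Q (f x)) → ∀ xs → length (filter P? xs) ≤ length (filter Q? (map f xs))
length-filter-map P? Q? f P⇒Q [] = z≤n
length-filter-map P? Q? f P⇒Q (x ∷ xs) with P? x | Q? (f x)
... | yes _  | yes _ = s≤s (length-filter-map P? Q? f P⇒Q xs)
... | yes px | no ¬q = ⊥-elim (¬q (P⇒Q px))
... | no _   | yes _ = m≤n⇒m≤1+n (length-filter-map P? Q? f P⇒Q xs)
... | no _   | no _  = length-filter-map P? Q? f P⇒Q xs

shift : ℕ → ℕ → Duo → Duo
shift a b e s = a + row e s , b + col e s

transpose : Duo → Duo
transpose e s = swap (e s)

Packing : ℕ → ℕ → List Duo → Set
Packing n₁ n₂ L = AllPairs Compatible L × All (Placed n₁ n₂) L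

compatible-sym : ∀ {e f} → Compatible e f → Compatible f e
compatible-sym ef s t eq = Product.map ≢-sym ≢-sym (ef t s (sym eq))

-- The condition on cells is symmetric in rows and columns. The one on corners turns into the
-- original condition at `not s` and `not t`.
compatible-transpose : ∀ {e f} → Compatible e f → Compatible (transpose e) (transpose f)
compatible-transpose {e} {f} ef s t col≡ =
  (λ row≡ → proj₁ (ef s t row≡) col≡) ,
  (λ row≡ → proj₂ (ef (not s) (not t) row≡)
    (subst₂ (λ s′ t′ → col e s′ ≡ col f t′) (sym (not-involutive s)) (sym (not-involutive t)) col≡))

transpose-packing : ∀ {n₁ n₂ L} → Packing n₁ n₂ L → Packing n₂ n₁ (map transpose L)
transpose-packing (c , p) =
  AllPairs.map⁺ (AllPairs.map compatible-transpose c) ,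
  All.map⁺ (All.map (λ { (skew , within) → swap skew , swap ∘ within }) p)

compatible-shift : ∀ a b {e f} → Compatible e f → Compatible (shift a b e) (shift a b f)
compatible-shift a b ef s t eq with ef s t (+-cancelˡ-≡ a _ _ eq)
... | ≢₁ , ≢₂ = ≢₁ ∘ +-cancelˡ-≡ b _ _ , ≢₂ ∘ +-cancelˡ-≡ b _ _

placed-shift : ∀ a b {n₁ n₂ e} → Placed n₁ n₂ e → Placed (a + n₁) (b + n₂) (shift a b e)
placed-shift a b ((r , c) , within) =
  (r ∘ +-cancelˡ-≡ a _ _ , c ∘ +-cancelˡ-≡ b _ _) ,
  λ s → Product.map (+-monoʳ-< a) (+-monoʳ-< b) (within s)

placed-mono : ∀ {m₁ m₂ n₁ n₂ e} → m₁ ≤ n₁ → m₂ ≤ n₂ → Placed m₁ m₂ e → Placed n₁ n₂ e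
placed-mono ≤₁ ≤₂ (skew , within) =
  skew , λ s → Product.map (λ p → <-≤-trans p ≤₁) (λ p → <-≤-trans p ≤₂) (within s)

-- A duo's cells and opposite corners use the same two columns, so duos from blocks with disjoint
-- column ranges cannot clash. In `above` no two rows agree across the blocks.
beside : ∀ {n a b L M} → Packing n a L → Packing n b M →
  Packing n (a + b) (L ++ map (shift 0 a) M)
beside {a = a} {b} (cL , pL) (cM , pM) =
  AllPairs.++⁺ cL (AllPairs.map⁺ (AllPairs.map (compatible-shift 0 a) cM))
    (All.map (λ e-in → All.map⁺ (All.map (λ {f} _ → apart {f = f} (proj₂ e-in)) pM)) pL) ,
  All.++⁺ (All.map (placed-mono ≤-refl (m≤m+n a b)) pL) (All.map⁺ (All.map (placed-shift 0 a) pM))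
  where
  apart : ∀ {n e f} → Within n a e → Compatible e (shift 0 a f)
  apart {e = e} e-in s t _ =
    <⇒≢ (<-≤-trans (proj₂ (e-in s)) (m≤m+n a _)) , <⇒≢ (<-≤-trans (proj₂ (e-in (not s))) (m≤m+n a _))

above : ∀ {n a b L M} → Packing a n L → Packing b n M →
  Packing (a + b) n (L ++ map (shift a 0) M)
above {a = a} {b} (cL , pL) (cM , pM) =
  AllPairs.++⁺ cL (AllPairs.map⁺ (AllPairs.map (compatible-shift a 0) cM))
    (All.map (λ e-in → All.map⁺ (All.map (λ {f} _ → apart {f = f} (proj₂ e-in)) pM)) pL) ,
  All.++⁺ (All.map (placed-mono (m≤m+n a b) ≤-refl) pL) (All.map⁺ (All.map (placed-shift a 0) pM))
  where
  apart : ∀ {n e f} → Within a n e → Compatible e (shift a 0 f)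
  apart e-in s t eq = ⊥-elim (<⇒≢ (<-≤-trans (proj₁ (e-in s)) (m≤m+n a _)) eq)

-- Ladders: packings that fill strips of width two or four.

cyclicPred : ℕ → ℕ → ℕ
cyclicPred m zero    = m
cyclicPred m (suc r) = r

-- The cyclic step puts the two cells in different rows, while the `2 + m` rungs together still
-- cover each cell of both columns exactly once.
rung : ℕ → ℕ → Duo
rung m r = duo r 0 (cyclicPred (1 + m) r) 1

ladder : ℕ → List Duo
ladder m = applyUpTo (rung m) (2 + m)

-- Cells of two different rungs in the same column lie in different rows, because the cyclic
-- predecessor is injective. So rows can agree only across the two columns, and there both
-- conditions compare column 0 with column 1.
ladder-packing : ∀ m → Packing (2 + m) 2 (ladder m)
ladder-packing m =
  AllPairs.applyUpTo⁺₁ (rung m) (2 + m) (λ i<j j<n → rungs (<⇒≢ i<j) (pred≢ i<j j<n)) ,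
  All.applyUpTo⁺₁ (rung m) (2 + m) rung-placed
  where
  rungs : ∀ {u v u′ v′} → u ≢ u′ → v ≢ v′ → Compatible (duo u 0 v 1) (duo u′ 0 v′ 1)
  rungs u≢ v≢ false false eq = ⊥-elim (u≢ eq)
  rungs u≢ v≢ false true  eq = (λ ()) , λ ()
  rungs u≢ v≢ true  false eq = (λ ()) , λ ()
  rungs u≢ v≢ true  true  eq = ⊥-elim (v≢ eq)
  pred≢ : ∀ {i j} → i < j → j < 2 + m → cyclicPred (1 + m) i ≢ cyclicPred (1 + m) j
  pred≢ {zero}  {suc j} _         j<n eq = <⇒≢ (≤-pred j<n) (sym eq)
  pred≢ {suc i} {suc j} (s≤s i<j) _   eq = <⇒≢ i<j eq
  rung-placed : ∀ {r} → r < 2 + m → Placed (2 + m) 2 (rung m r)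
  rung-placed {zero}  r<n = ((λ ()) , λ ()) , λ { false → r<n , s≤s z≤n ; true → ≤-refl , ≤-refl }
  rung-placed {suc r} r<n = (1+n≢n , λ ()) , λ { false → r<n , s≤s z≤n ; true → <-trans ≤-refl r<n , ≤-refl }

doubleLadder : ℕ → List Duo
doubleLadder m = ladder m ++ map (shift 0 2) (ladder m)

doubleLadder-packing : ∀ m → Packing (2 + m) 4 (doubleLadder m)
doubleLadder-packing m = beside (ladder-packing m) (ladder-packing m)

length-ladder : ∀ m → length (ladder m) ≡ 2 + m
length-ladder m = length-applyUpTo (rung m) (2 + m)

length-++-map : ∀ (L M : List Duo) f → length (L ++ map f M) ≡ length L + length M
length-++-map L M f = trans (length-++ L) (cong (length L +_) (length-map f M))

length-doubleLadder : ∀ m → length (doubleLadder m) ≡ (2 + m) + (2 + m)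
length-doubleLadder m =
  trans (length-++-map (ladder m) (ladder m) _) (cong₂ _+_ (length-ladder m) (length-ladder m))

-- Flexible grids, and growing them.

-- Every size between ⌈3n₂/2⌉ and ⌊n₁n₂/2⌋ is attained by a packing lying between core and full,
-- and such a packing inherits the degrees of core.
record Flexible (n₁ n₂ : ℕ) : Set where
  field
    full core  : List Duo
    packing    : Packing n₁ n₂ full
    core⊆full  : core ⊆ full
    core-small : 2 * length core ≤ 1 + 3 * n₂
    full-large : n₁ * n₂ ≤ 1 + 2 * length full
    rows       : ∀ {r} → r < n₁ → 3 ≤ degree proj₁ r core
    cols       : ∀ {c} → c < n₂ → 3 ≤ degree proj₂ c core

split-< : ∀ a {b k} → k < a + b → k < a ⊎ ∃[ j ] k ≡ a + j × j < b
split-< zero    k<b             = inj₂ (_ , refl , k<b)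
split-< (suc a) {k = zero}  _         = inj₁ (s≤s z≤n)
split-< (suc a) {k = suc k} (s≤s k<)  with split-< a k<
... | inj₁ k<a            = inj₁ (s≤s k<a)
... | inj₂ (j , eq , j<b) = inj₂ (j , cong suc eq , j<b)

degree-shift₁ : ∀ a b k L → degree proj₁ k L ≤ degree proj₁ (a + k) (map (shift a b) L)
degree-shift₁ a b k = length-filter-map (hits? proj₁ k) (hits? proj₁ (a + k)) (shift a b)
  [ inj₁ ∘ cong (a +_) , inj₂ ∘ cong (a +_) ]′

degree-shift₂ : ∀ a b k L → degree proj₂ k L ≤ degree proj₂ (b + k) (map (shift a b) L)
degree-shift₂ a b k = length-filter-map (hits? proj₂ k) (hits? proj₂ (b + k)) (shift a b)
  [ inj₁ ∘ cong (b +_) , inj₂ ∘ cong (b +_) ]′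

degree-++ˡ : ∀ π k L M → degree π k L ≤ degree π k (L ++ M)
degree-++ˡ π k L M = degree-⊆ π k (++⁺ʳ M (⊆-refl {x = L}))

degree-++ʳ : ∀ π k L M → degree π k M ≤ degree π k (L ++ M)
degree-++ʳ π k L M = degree-⊆ π k (++⁺ˡ L ⊆-refl)

-- Two columns carrying a full ladder are put in front. The ladder uses all `2 * (3 + m)` new cells.
-- Three of its rungs join the core: they give both new columns degree 3 and add exactly 6 = 3 * 2
-- to `2 * length core`.
widen : ∀ {m n} → Flexible (3 + m) n → Flexible (3 + m) (2 + n)
widen {m} {n} flexible = record
  { full = ladder (1 + m) ++ map (shift 0 2) full
  ; core = rungs ++ map (shift 0 2) core
  ; packing = beside (ladder-packing (1 + m)) packing
  ; core⊆full = ++⁺ (take-⊆ 3 (ladder (1 + m))) (map⁺ _ core⊆full)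
  ; core-small = begin
      2 * length (rungs ++ map (shift 0 2) core) ≡⟨ cong (2 *_) (length-++-map rungs core _) ⟩
      2 * (3 + length core)                      ≡⟨ *-distribˡ-+ 2 3 _ ⟩
      6 + 2 * length core                        ≤⟨ +-monoʳ-≤ 6 core-small ⟩
      6 + (1 + 3 * n)
        ≡⟨ solve 1 (λ n → con 6 :+ (con 1 :+ con 3 :* n) := con 1 :+ con 3 :* (con 2 :+ n)) refl n ⟩
      1 + 3 * (2 + n)                            ∎
  ; full-large = begin
      (3 + m) * (2 + n)
        ≡⟨ solve 2 (λ m n → (con 3 :+ m) :* (con 2 :+ n) := con 2 :* (con 3 :+ m) :+ (con 3 :+ m) :* n) refl m n ⟩
      2 * (3 + m) + (3 + m) * n             ≤⟨ +-monoʳ-≤ (2 * (3 + m)) full-large ⟩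
      2 * (3 + m) + (1 + 2 * length full)
        ≡⟨ solve 2 (λ m f → con 2 :* (con 3 :+ m) :+ (con 1 :+ con 2 :* f) := con 1 :+ con 2 :* (con 3 :+ m :+ f)) refl m (length full) ⟩
      1 + 2 * (3 + m + length full)
        ≡⟨ cong (λ k → 1 + 2 * (k + length full)) (sym (length-ladder (1 + m))) ⟩
      1 + 2 * (length (ladder (1 + m)) + length full)
        ≡⟨ cong (λ k → 1 + 2 * k) (sym (length-++-map (ladder (1 + m)) full _)) ⟩
      1 + 2 * length (ladder (1 + m) ++ map (shift 0 2) full) ∎
  ; rows = λ {r} r< → ≤-trans (rows r<) (≤-trans (degree-shift₁ 0 2 r core) (degree-++ʳ proj₁ r rungs (map (shift 0 2) core)))
  ; cols = λ c< → cols′ (split-< 2 c<)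
  }
  where
  open Flexible flexible
  open ≤-Reasoning
  open +-*-Solver
  rungs : List Duo
  rungs = take 3 (ladder (1 + m))
  cols′ : ∀ {c} → c < 2 ⊎ ∃[ j ] c ≡ 2 + j × j < n → 3 ≤ degree proj₂ c (rungs ++ map (shift 0 2) core)
  cols′ {zero}  (inj₁ _) = s≤s (s≤s (s≤s z≤n))
  cols′ {suc zero}  (inj₁ _) = s≤s (s≤s (s≤s z≤n))
  cols′ {suc (suc _)}  (inj₁ (s≤s (s≤s ())))
  cols′ (inj₂ (j , refl , j<n)) =
    ≤-trans (cols j<n) (≤-trans (degree-shift₂ 0 2 j core) (degree-++ʳ proj₂ (2 + j) rungs (map (shift 0 2) core)))

-- Small grids, verified by evaluation.

-- The core is a prefix, so a list and a number determine all the data, and every condition is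
-- decidable.
Checks : ℕ → ℕ → ℕ → List Duo → Set
Checks n₁ n₂ k full = Packing n₁ n₂ full ×
  2 * length (take k full) ≤ 1 + 3 * n₂ × n₁ * n₂ ≤ 1 + 2 * length full ×
  (∀ {r} → r < n₁ → 3 ≤ degree proj₁ r (take k full)) ×
  (∀ {c} → c < n₂ → 3 ≤ degree proj₂ c (take k full))

checks? : ∀ n₁ n₂ k full → Dec (Checks n₁ n₂ k full)
checks? n₁ n₂ k full =
  (AllPairs.allPairs? compatible? full ×-dec All.all? (placed? n₁ n₂) full) ×-dec
  (_ ≤? _) ×-dec (_ ≤? _) ×-dec
  allUpTo? (λ r → 3 ≤? degree proj₁ r (take k full)) n₁ ×-dec
  allUpTo? (λ c → 3 ≤? degree proj₂ c (take k full)) n₂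

tabulated : ∀ n₁ n₂ k full → {True (checks? n₁ n₂ k full)} → Flexible n₁ n₂
tabulated n₁ n₂ k full {t} with toWitness t
... | p , s , l , rs , cs = record
  { full = full ; core = take k full ; packing = p ; core⊆full = take-⊆ k full
  ; core-small = s ; full-large = l ; rows = rs ; cols = cs }

-- Pairs of consecutive cells of the walk (t, t) on the n₁ × n₂ torus, which is shifted by one
-- column after each period; ℓ is meant to be lcm n₁ n₂.
diagonal : ∀ n₁ n₂ ℓ → .{{NonZero n₁}} → .{{NonZero n₂}} → .{{NonZero ℓ}} → List Duo
diagonal n₁ n₂ ℓ = applyUpTo (λ i → λ { false → cell (2 * i) ; true → cell (1 + 2 * i) }) (n₁ * n₂ / 2)
  where
  cell : ℕ → ℕ × ℕ
  cell t = t % n₁ , (t + t / ℓ) % n₂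

flexible₃₄ : Flexible 3 4
flexible₃₄ = tabulated 3 4 6 (diagonal 3 4 12)

flexible₄₄ : Flexible 4 4
flexible₄₄ = tabulated 4 4 6 (diagonal 4 4 4)

flexible₄₅ : Flexible 4 5
flexible₄₅ = tabulated 4 5 8 (diagonal 4 5 20)

flexible₅₆ : Flexible 5 6
flexible₅₆ = tabulated 5 6 9 (diagonal 5 6 30)

flexible₆₆ : Flexible 6 6
flexible₆₆ = tabulated 6 6 9 (diagonal 6 6 6)

flexible₆₇ : Flexible 6 7
flexible₆₇ = tabulated 6 7 11 (diagonal 6 7 42)

-- The 12 duos leave one of the 25 cells free. The 8 core duos have 16 cells, one more than three
-- per row requires; the parity forces both defects.
flexible₅₅ : Flexible 5 5
flexible₅₅ = tabulated 5 5 8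
  ( duo 0 2 1 0 ∷ duo 0 3 1 1 ∷ duo 1 3 2 0 ∷ duo 1 4 2 1 ∷ duo 0 1 2 4 ∷ duo 3 0 4 1
  ∷ duo 3 2 4 3 ∷ duo 3 4 4 2 ∷ duo 0 4 1 2 ∷ duo 0 0 2 3 ∷ duo 3 1 4 0 ∷ duo 3 3 4 4
  ∷ [] )

flexible₇₇ : Flexible 7 7
flexible₇₇ = tabulated 7 7 11
  ( duo 0 1 1 0 ∷ duo 0 2 1 1 ∷ duo 1 2 2 0 ∷ duo 0 0 2 2 ∷ duo 2 3 0 4 ∷ duo 3 1 4 2
  ∷ duo 5 5 6 6 ∷ duo 3 4 4 5 ∷ duo 5 6 6 3 ∷ duo 3 5 4 6 ∷ duo 5 3 6 4 ∷ duo 0 3 1 4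
  ∷ duo 1 3 2 4 ∷ duo 0 5 1 6 ∷ duo 1 5 2 6 ∷ duo 2 5 0 6 ∷ duo 3 0 4 1 ∷ duo 3 2 4 0
  ∷ duo 5 0 6 1 ∷ duo 5 1 6 2 ∷ duo 5 2 6 0 ∷ duo 3 3 4 4 ∷ duo 3 6 4 3 ∷ duo 5 4 6 5
  ∷ [] )

-- The grid is cut into four blocks: a 4 × 4 packing, a double ladder below it, a transposed double
-- ladder to its right, and the given packing in the remaining corner. The core takes only the cores
-- of the two diagonal blocks, which between them meet every row and column; the 6 new core duos
-- match 2 * 6 = 3 * 4.
enlarge : ∀ {a b} → Flexible (2 + a) (2 + b) → Flexible (6 + a) (6 + b)
enlarge {a} {b} flexible = record
  { full = left ++ map (shift 0 4) right
  ; core = Q.core ++ corner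
  ; packing = beside
      (above Q.packing (doubleLadder-packing a))
      (above (transpose-packing (doubleLadder-packing b)) packing)
  ; core⊆full = ++⁺ (++⁺ʳ (map (shift 4 0) (doubleLadder a)) Q.core⊆full)
      (map⁺ (shift 0 4) (++⁺ˡ (map transpose (doubleLadder b)) (map⁺ (shift 4 0) core⊆full)))
  ; core-small = begin
      2 * length (Q.core ++ corner)
        ≡⟨ cong (2 *_) (trans (length-++-map Q.core (map (shift 4 0) core) _) (cong (6 +_) (length-map _ core))) ⟩
      2 * (6 + length core)         ≡⟨ *-distribˡ-+ 2 6 _ ⟩
      12 + 2 * length core          ≤⟨ +-monoʳ-≤ 12 core-small ⟩
      12 + (1 + 3 * (2 + b))
        ≡⟨ solve 1 (λ b → con 12 :+ (con 1 :+ con 3 :* (con 2 :+ b)) := con 1 :+ con 3 :* (con 6 :+ b)) refl b ⟩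
      1 + 3 * (6 + b)               ∎
  ; full-large = begin
      (6 + a) * (6 + b)
        ≡⟨ solve 2 (λ a b → (con 6 :+ a) :* (con 6 :+ b) := con 32 :+ con 4 :* a :+ con 4 :* b :+ (con 2 :+ a) :* (con 2 :+ b)) refl a b ⟩
      32 + 4 * a + 4 * b + (2 + a) * (2 + b)
        ≤⟨ +-monoʳ-≤ (32 + 4 * a + 4 * b) full-large ⟩
      32 + 4 * a + 4 * b + (1 + 2 * length full)
        ≡⟨ solve 3 (λ a b f → con 32 :+ con 4 :* a :+ con 4 :* b :+ (con 1 :+ con 2 :* f) :=
             con 1 :+ con 2 :* ((con 8 :+ ((con 2 :+ a) :+ (con 2 :+ a))) :+ (((con 2 :+ b) :+ (con 2 :+ b)) :+ f))) refl a b (length full) ⟩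
      1 + 2 * ((8 + ((2 + a) + (2 + a))) + (((2 + b) + (2 + b)) + length full))
        ≡⟨ cong₂ (λ x y → 1 + 2 * ((8 + x) + (y + length full)))
             (sym (length-doubleLadder a))
             (sym (trans (length-map transpose (doubleLadder b)) (length-doubleLadder b))) ⟩
      1 + 2 * ((8 + length (doubleLadder a)) + (length (map transpose (doubleLadder b)) + length full))
        ≡⟨ cong₂ (λ x y → 1 + 2 * (x + y))
             (sym (length-++-map Q.full (doubleLadder a) _))
             (sym (length-++-map (map transpose (doubleLadder b)) full _)) ⟩
      1 + 2 * (length left + length right)
        ≡⟨ cong (λ x → 1 + 2 * x) (sym (length-++-map left right _)) ⟩
      1 + 2 * length (left ++ map (shift 0 4) right) ∎
  ; rows = λ r< → rows′ (split-< 4 r<)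
  ; cols = λ c< → cols′ (split-< 4 c<)
  }
  where
  open Flexible flexible
  module Q = Flexible flexible₄₄
  open ≤-Reasoning
  open +-*-Solver
  left right corner : List Duo
  corner = map (shift 0 4) (map (shift 4 0) core)
  left  = Q.full ++ map (shift 4 0) (doubleLadder a)
  right = map transpose (doubleLadder b) ++ map (shift 4 0) full
  rows′ : ∀ {r} → r < 4 ⊎ ∃[ j ] r ≡ 4 + j × j < 2 + a →
    3 ≤ degree proj₁ r (Q.core ++ corner)
  rows′ {r} (inj₁ r<4) = ≤-trans (Q.rows r<4) (degree-++ˡ proj₁ r Q.core corner)
  rows′ (inj₂ (j , refl , j<)) = ≤-trans (rows j<) (≤-trans (degree-shift₁ 4 0 j core)
    (≤-trans (degree-shift₁ 0 4 (4 + j) (map (shift 4 0) core)) (degree-++ʳ proj₁ (4 + j) Q.core corner)))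
  cols′ : ∀ {c} → c < 4 ⊎ ∃[ j ] c ≡ 4 + j × j < 2 + b →
    3 ≤ degree proj₂ c (Q.core ++ corner)
  cols′ {c} (inj₁ c<4) = ≤-trans (Q.cols c<4) (degree-++ˡ proj₂ c Q.core corner)
  cols′ (inj₂ (j , refl , j<)) = ≤-trans (cols j<) (≤-trans (degree-shift₂ 4 0 j core)
    (≤-trans (degree-shift₂ 0 4 (0 + j) (map (shift 4 0) core)) (degree-++ʳ proj₂ (4 + j) Q.core corner)))

-- Induction over all grid sizes.

flexible-n,n : ∀ n → Flexible (4 + n) (4 + n)
flexible-n,n 0 = flexible₄₄
flexible-n,n 1 = flexible₅₅
flexible-n,n 2 = flexible₆₆
flexible-n,n 3 = flexible₇₇
flexible-n,n (suc (suc (suc (suc n)))) = enlarge (flexible-n,n n)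

flexible-n,1+n : ∀ n → Flexible (3 + n) (4 + n)
flexible-n,1+n 0 = flexible₃₄
flexible-n,1+n 1 = flexible₄₅
flexible-n,1+n 2 = flexible₅₆
flexible-n,1+n 3 = flexible₆₇
flexible-n,1+n (suc (suc (suc (suc n)))) = enlarge (flexible-n,1+n n)

flexible-n,d+n : ∀ n d → Flexible (4 + n) (d + (4 + n))
flexible-n,d+n n 0             = flexible-n,n n
-- The near-square family starts at three rows, the square one at four, hence the index `1 + n`.
flexible-n,d+n n 1             = flexible-n,1+n (1 + n)
flexible-n,d+n n (suc (suc d)) = widen (flexible-n,d+n n d)

-- With three rows the two bounds on `2 * n₃` coincide, so `3 * n₂` is even and odd widths do not
-- occur. Adding two columns preserves the parity.
flexible-3,d+3 : ∀ d → 2 ∣ 3 * (d + 3) → Flexible 3 (d + 3)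
flexible-3,d+3 0             2∣ = ⊥-elim (toWitnessFalse {a? = 2 ∣? 9} _ 2∣)
flexible-3,d+3 1             2∣ = flexible₃₄
flexible-3,d+3 (suc (suc d)) 2∣ = widen (flexible-3,d+3 d (∣m+n∣m⇒∣n (subst (2 ∣_) (*-distribˡ-+ 3 2 (d + 3)) 2∣) (divides 3 refl)))

-- From a packing of the right size to a design.

between : ∀ {A : Set} {xs ys : List A} k → xs ⊆ ys → length xs ≤ k → k ≤ length ys →
  ∃[ zs ] xs ⊆ zs × zs ⊆ ys × length zs ≡ k
between zero    []           _         _         = [] , [] , [] , refl
between (suc k) []           _         ()
between zero    (y ∷ʳ τ)     len≤      _         with between 0 τ len≤ z≤n
... | zs , σ , ρ , eq = zs , σ , y ∷ʳ ρ , eq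
between {xs = xs} (suc k) (y ∷ʳ τ) len≤ (s≤s k≤) with length xs ≤? k
-- The extra element `y` is kept as long as `xs` leaves room for it.
... | yes len≤k with between k τ len≤k k≤
...   | zs , σ , ρ , eq = y ∷ zs , y ∷ʳ σ , refl ∷ ρ , cong suc eq
between {xs = xs} (suc k) (y ∷ʳ τ) len≤ (s≤s k≤) | no len≰k =
  xs , ⊆-refl , y ∷ʳ τ , ≤-antisym len≤ (≰⇒> len≰k)
between (suc k) (refl ∷ τ)   (s≤s len≤) (s≤s k≤) with between k τ len≤ k≤
... | zs , σ , ρ , eq = _ ∷ zs , refl ∷ σ , refl ∷ ρ , cong suc eq

AllPairs-resp-⊆ : ∀ {A : Set} {R : A → A → Set} {xs ys} → xs ⊆ ys → AllPairs R ys → AllPairs R xs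
AllPairs-resp-⊆ []         []       = []
AllPairs-resp-⊆ (_ ∷ʳ τ)   (_ ∷ Ry) = AllPairs-resp-⊆ τ Ry
AllPairs-resp-⊆ (refl ∷ τ) (r ∷ Ry) = All-resp-⊆ τ r ∷ AllPairs-resp-⊆ τ Ry

AllPairs-lookup : ∀ {A : Set} {R : A → A → Set} → (∀ {x y} → R x y → R y x) →
  ∀ {xs} → AllPairs R xs → ∀ {i j} → i ≢ j → R (lookup xs i) (lookup xs j)
AllPairs-lookup R-sym (r ∷ Rxs) {zero}  {zero}  i≢j = ⊥-elim (i≢j refl)
AllPairs-lookup R-sym (r ∷ Rxs) {zero}  {suc j} i≢j = All.lookup r (∈-lookup j)
AllPairs-lookup R-sym (r ∷ Rxs) {suc i} {zero}  i≢j = R-sym (All.lookup r (∈-lookup i))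
AllPairs-lookup R-sym (r ∷ Rxs) {suc i} {suc j} i≢j = AllPairs-lookup R-sym Rxs (i≢j ∘ cong suc)

select : ∀ {A : Set} {P : A → Set} (P? : Decidable P) m xs → m ≤ length (filter P? xs) →
  ∃[ ks ] length ks ≡ m × Unique ks × All (P ∘ lookup xs) ks
select P? zero    xs       _  = [] , refl , [] , []
select P? (suc m) (x ∷ xs) m≤ with P? x
select P? (suc m) (x ∷ xs) (s≤s m≤) | yes px with select P? m xs m≤
... | ks , len , unique , all = zero ∷ map suc ks , cong suc (trans (length-map suc ks) len) ,
  All.map⁺ (All.tabulate λ _ ()) ∷ Unique.map⁺ suc-injective unique , px ∷ All.map⁺ all
select P? (suc m) (x ∷ xs) m≤ | no _ with select P? (suc m) xs m≤
... | ks , len , unique , all = map suc ks , trans (length-map suc ks) len ,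
  Unique.map⁺ suc-injective unique , All.map⁺ all

-- Among three items with different keys, `A` and `B` can each spoil at most one.
sound-of-three : ∀ {X I : Set} {A B : X → Set} (key : X → I) (A? : Decidable A) (B? : Decidable B) →
  (P : X → Set) →
  (∀ {x y} → P x → P y → A x → A y → key x ≡ key y) →
  (∀ {x y} → P x → P y → B x → B y → key x ≡ key y) →
  ∀ {x y z} → P x → P y → P z → key x ≢ key y → key x ≢ key z → key y ≢ key z →
  ∃[ w ] P w × ¬ A w × ¬ B w
sound-of-three key A? B? P A≡ B≡ {x} {y} {z} px py pz x≢y x≢z y≢z with A? x | B? x | A? y | B? y
... | no ¬a | no ¬b | _     | _     = x , px , ¬a , ¬b
... | _     | _     | no ¬a | no ¬b = y , py , ¬a , ¬b
... | yes a | _     | yes a′ | _    = ⊥-elim (x≢y (A≡ px py a a′))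
... | _     | yes b | _     | yes b′ = ⊥-elim (x≢y (B≡ px py b b′))
... | yes a | _     | _     | yes b = z , pz , x≢z ∘ A≡ px pz a , y≢z ∘ B≡ py pz b
... | _     | yes b | yes a | _     = z , pz , y≢z ∘ A≡ py pz a , x≢z ∘ B≡ px pz b

-- Three duos on line `r` belong to three different layers. The crossing line contains at most one
-- of their cells on `r`, since two would be the same cell, and at most one belongs to the discarded
-- layer. The `suc` leaves 0 for the coordinates of the origin.
rich : ∀ L (π ρ : ℕ × ℕ → ℕ) →
  (∀ i j s t → π (lookup L i s) ≡ π (lookup L j t) → ρ (lookup L i s) ≡ ρ (lookup L j t) → i ≡ j) →
  ∀ r → 3 ≤ degree π r L → ∀ c (k : Fin (suc (length L))) →
  ∃[ i ] ∃[ s ] π (lookup L i s) ≡ r × suc (ρ (lookup L i s)) ≢ c × suc i ≢ k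
rich L π ρ inj r 3≤ c k with select (hits? π r) 3 L 3≤
... | i₁ ∷ i₂ ∷ i₃ ∷ [] , refl , ((≢₁₂ ∷ ≢₁₃ ∷ []) ∷ (≢₂₃ ∷ []) ∷ _) , h₁ ∷ h₂ ∷ h₃ ∷ []
  with side i₁ h₁ | side i₂ h₂ | side i₃ h₃
  where
  side : ∀ i → Hits π r (lookup L i) → ∃[ s ] π (lookup L i s) ≡ r
  side i (inj₁ eq) = false , eq
  side i (inj₂ eq) = true , eq
... | s₁ , e₁ | s₂ , e₂ | s₃ , e₃
  with sound-of-three {X = Fin (length L) × Bool} proj₁
         (λ (i , s) → suc (ρ (lookup L i s)) ≟ c) (λ (i , s) → suc i ≟ᶠ k)
         (λ (i , s) → π (lookup L i s) ≡ r)
         (λ {(i , s)} {(j , t)} p q a b → inj i j s t (trans p (sym q)) (Nat.suc-injective (trans a (sym b))))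
         (λ _ _ a b → suc-injective (trans a (sym b)))
         {i₁ , s₁} {i₂ , s₂} {i₃ , s₃} e₁ e₂ e₃ ≢₁₂ ≢₁₃ ≢₂₃
... | (i , s) , p , ¬a , ¬b = i , s , p , ¬a , ¬b

design : ∀ {n₁ n₂} L → Packing n₁ n₂ L → (∀ {r} → r < n₁ → 3 ≤ degree proj₁ r L) →
  (∀ {c} → c < n₂ → 3 ≤ degree proj₂ c L) → Design n₁ n₂ (length L)
design {n₁} {n₂} L (compat , placed) rows cols = record
  { row = row′
  ; col = col′
  ; row-skew = λ i → proj₁ (proj₁ (at i)) ∘ row-inj {i} {i} {false} {true}
  ; col-skew = λ i → proj₂ (proj₁ (at i)) ∘ col-inj {i} {i} {false} {true}
  ; opposite-injective = λ {i} {j} {s} {t} r≡ c≡ → decidable-stable (i ≟ᶠ j)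
      λ i≢j → proj₂ (apart i≢j s t (row-inj {i} {j} r≡)) (col-inj {i} {j} c≡)
  ; row-rich = row-rich′
  ; col-rich = col-rich′
  }
  where
  at : ∀ i → Placed n₁ n₂ (lookup L i)
  at i = All.lookup placed (∈-lookup i)
  row′ : Fin (length L) → Bool → Fin n₁
  row′ i s = fromℕ< (proj₁ (proj₂ (at i) s))
  col′ : Fin (length L) → Bool → Fin n₂
  col′ i s = fromℕ< (proj₂ (proj₂ (at i) s))
  toℕ-row : ∀ i s → toℕ (row′ i s) ≡ row (lookup L i) s
  toℕ-row i s = toℕ-fromℕ< _
  toℕ-col : ∀ i s → toℕ (col′ i s) ≡ col (lookup L i) s
  toℕ-col i s = toℕ-fromℕ< _
  row-inj : ∀ {i j s t} → row′ i s ≡ row′ j t → row (lookup L i) s ≡ row (lookup L j) t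
  row-inj {i} {j} {s} {t} eq = trans (sym (toℕ-row i s)) (trans (cong toℕ eq) (toℕ-row j t))
  col-inj : ∀ {i j s t} → col′ i s ≡ col′ j t → col (lookup L i) s ≡ col (lookup L j) t
  col-inj {i} {j} {s} {t} eq = trans (sym (toℕ-col i s)) (trans (cong toℕ eq) (toℕ-col j t))
  apart : ∀ {i j} → i ≢ j → Compatible (lookup L i) (lookup L j)
  apart = AllPairs-lookup compatible-sym compat
  row-rich′ : ∀ r (c : Fin (suc n₂)) k → ∃[ i ] ∃[ s ] row′ i s ≡ r × suc (col′ i s) ≢ c × suc i ≢ k
  row-rich′ r c k with rich L proj₁ proj₂
      (λ i j s t r≡ c≡ → decidable-stable (i ≟ᶠ j) λ i≢j → proj₁ (apart i≢j s t r≡) c≡)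
      (toℕ r) (rows (toℕ<n r)) (toℕ c) k
  ... | i , s , r≡ , c≢ , k≢ = i , s , toℕ-injective (trans (toℕ-row i s) r≡) ,
    (λ c≡ → c≢ (trans (cong suc (sym (toℕ-col i s))) (cong toℕ c≡))) , k≢
  col-rich′ : ∀ c (r : Fin (suc n₁)) k → ∃[ i ] ∃[ s ] col′ i s ≡ c × suc (row′ i s) ≢ r × suc i ≢ k
  col-rich′ c r k with rich L proj₂ proj₁
      (λ i j s t c≡ r≡ → decidable-stable (i ≟ᶠ j) λ i≢j → proj₁ (apart i≢j s t r≡) c≡)
      (toℕ c) (cols (toℕ<n c)) (toℕ r) k
  ... | i , s , c≡ , r≢ , k≢ = i , s , toℕ-injective (trans (toℕ-col i s) c≡) ,
    (λ r≡ → r≢ (trans (cong suc (sym (toℕ-row i s))) (cong toℕ r≡))) , k≢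

-- Fitting the size `n₃` and conclusion.

-- Parity absorbs the slack of 1 that `core-small` and `full-large` allow for odd products.
halve-≤ : ∀ {m n} → 2 * m ≤ 1 + 2 * n → m ≤ n
halve-≤ {m} {n} 2m≤ = ≮⇒≥ λ n<m → <⇒≱ (*-monoʳ-≤ 2 n<m) (subst (2 * m ≤_) (sym (+-suc n _)) 2m≤)

design-of-flexible : ∀ {n₁ n₂ n₃} → Flexible n₁ n₂ → 3 * n₂ ≤ 2 * n₃ → 2 * n₃ ≤ n₁ * n₂ → Design n₁ n₂ n₃
design-of-flexible {n₃ = n₃} flexible 3n₂≤ ≤n₁n₂
  with between n₃ (Flexible.core⊆full flexible)
         (halve-≤ (≤-trans (Flexible.core-small flexible) (s≤s 3n₂≤)))
         (halve-≤ (≤-trans ≤n₁n₂ (Flexible.full-large flexible)))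
... | L , core⊆L , L⊆full , refl = design L
  (AllPairs-resp-⊆ L⊆full (proj₁ packing) , All-resp-⊆ L⊆full (proj₂ packing))
  (λ {r} r< → ≤-trans (rows r<) (degree-⊆ proj₁ r core⊆L))
  (λ {c} c< → ≤-trans (cols c<) (degree-⊆ proj₂ c core⊆L))
  where open Flexible flexible

flexible : ∀ {n₁ n₂ n₃} → 3 ≤ n₁ → n₁ ≤ n₂ → 3 * n₂ ≤ 2 * n₃ → 2 * n₃ ≤ n₁ * n₂ → Flexible n₁ n₂
flexible {suc (suc (suc zero))} {n₂} {n₃} (s≤s (s≤s (s≤s _))) 3≤n₂ 3n₂≤ ≤3n₂ =
  subst (Flexible 3) (m∸n+n≡m 3≤n₂) (flexible-3,d+3 (n₂ ∸ 3) (subst (λ n → 2 ∣ 3 * n) (sym (m∸n+n≡m 3≤n₂))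
    (divides n₃ (trans (≤-antisym 3n₂≤ ≤3n₂) (*-comm 2 n₃)))))
flexible {suc (suc (suc (suc n)))} {n₂} (s≤s (s≤s (s≤s _))) n₁≤n₂ _ _ =
  subst (Flexible (4 + n)) (m∸n+n≡m n₁≤n₂) (flexible-n,d+n n (n₂ ∸ (4 + n)))

design-exists : ∀ n₁ n₂ n₃ → 3 ≤ n₁ → 3 ≤ n₂ → 3 * (n₁ ⊔ n₂) ≤ 2 * n₃ → 2 * n₃ ≤ n₁ * n₂ → Design n₁ n₂ n₃
design-exists n₁ n₂ n₃ 3≤n₁ 3≤n₂ max≤ ≤n₁n₂ with ≤-total n₁ n₂
... | inj₁ n₁≤n₂ = design-of-flexible (flexible {n₃ = n₃} 3≤n₁ n₁≤n₂ 3n₂≤ ≤n₁n₂) 3n₂≤ ≤n₁n₂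
  where
  3n₂≤ : 3 * n₂ ≤ 2 * n₃
  3n₂≤ = subst (λ k → 3 * k ≤ 2 * n₃) (m≤n⇒m⊔n≡n n₁≤n₂) max≤
... | inj₂ n₂≤n₁ = transpose-design (design-of-flexible (flexible {n₃ = n₃} 3≤n₂ n₂≤n₁ 3n₁≤ ≤n₂n₁) 3n₁≤ ≤n₂n₁)
  where
  3n₁≤ : 3 * n₁ ≤ 2 * n₃
  3n₁≤ = subst (λ k → 3 * k ≤ 2 * n₃) (m≥n⇒m⊔n≡m n₂≤n₁) max≤
  -- `flexible` expects the smaller side first, so here the grid is built transposed and the product
  -- bound has to be commuted.
  ≤n₂n₁ : 2 * n₃ ≤ n₂ * n₁
  ≤n₂n₁ = subst (2 * n₃ ≤_) (*-comm n₁ n₂) ≤n₁n₂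

mainTheorem10 : (n₁ n₂ n₃ : ℕ) → 3 ≤ n₁ → 3 ≤ n₂ → n₁ ≤ n₃ → n₂ ≤ n₃ →
    3 * (n₁ ⊔ n₂) ≤ 2 * n₃ → 2 * n₃ ≤ n₁ * n₂ →
    HasMetricDimension (K (n₁ + 1) ⊗ K (n₂ + 1) ⊗ K (n₃ + 1)) (2 * n₃ + 1)
mainTheorem10 n₁ n₂ n₃ 3≤n₁ 3≤n₂ n₁≤n₃ _ max≤ ≤n₁n₂
  rewrite +-comm n₁ 1 | +-comm n₂ 1 | +-comm n₃ 1 =
  metric-dimension (2≤ 3≤n₁) (2≤ 3≤n₂) (2≤ (≤-trans 3≤n₁ n₁≤n₃))
    (design-exists n₁ n₂ n₃ 3≤n₁ 3≤n₂ max≤ ≤n₁n₂)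
  where
  2≤ : ∀ {n} → 3 ≤ n → 2 ≤ n
  2≤ = ≤-trans (n≤1+n 2)
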